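{- Let $\mathcal I$ be a nonempty index set, let $\mathbf A$ be a locally finite quantifier theory with equality, and for each $i\in\mathcal I$ let $\mathbf B_i$ be a normal $2$-model of $\mathbf A$. Let $\mathbf B$ be the modification of $\mathbf A$ with $\mathbf B_*(\emptyset)=\prod_{i\in\mathcal I}2$ and $\mathbf B^*(\emptyset)=\prod_{i\in\mathcal I}\mathbf B_i^*(\emptyset)$, such that for nonempty $X\in\mathcal S$, $a\in\mathbf A^*(X)$, $p\in\mathbf A_*(X)$ and $\sigma:X\to\mathbf B^*(\emptyset)$ one has $(a\sigma)(i)=a\sigma_i$ and $(p\sigma)(i)=p\sigma_i$, where $\sigma_i(x)=\sigma(x)(i)$. Let $I$ be an ultrafilter of $\mathbf B_*(\emptyset)=\prod_{i\in\mathcal I}2$, and let $\theta$ be the equivalence relation on $(\mathbf B/I)^*(\emptyset)=\prod_{i\in\mathcal I}\mathbf B_i^*(\emptyset)$ given by $a\,\theta\,b$ iff $e(a,b)=1$ in $(\mathbf B/I)_*(\emptyset)=(\prod_{i\in\mathcal I}2)/I$. Then $(\mathbf B/I)/\theta$ is a normal $2$-model of $\mathbf A$.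
   Context: Throughout, $\mathcal S$ is a nonempty collection of sets containing at least one infinite set; $X,Y,Z,W$ denote members of $\mathcal S$ (sets of variables). Quantifier theory. A quantifier theory $\mathbf A$ over $\mathcal S$ consists of: a set $\mathbf A^*(X)$ and a map $\epsilon_X:X\to\mathbf A^*(X)$ for each $X$ (one writes $x$ for $\epsilon_X(x)$); a Boolean algebra $\mathbf A_*(X)$ for each $X$; an element $a\sigma\in\mathbf A^*(Y)$ for each nonempty $X$, $a\in\mathbf A^*(X)$ and map $\sigma:X\to\mathbf A^*(Y)$; an element $p\sigma\in\mathbf A_*(Y)$ for each nonempty $X$, $p\in\mathbf A_*(X)$ and map $\sigma:X\to\mathbf A^*(Y)$; an element $\forall x.p\in\mathbf A_*(X)$ for each nonempty $X$, $x\in X$, $p\in\mathbf A_*(X)$. Put $\mathbf A(X)=\mathbf A_*(X)\cup\mathbf A^*(X)$. For all nonempty $X$, $x\in X$, $t\in\mathbf A(X)$, $\sigma:X\to\mathbf A^*(Y)$, $p,q\in\mathbf A_*(X)$ the following hold. (P1) $t\epsilon_X=t$. (P2) $(t\sigma)\tau=t(\sigma\tau)$ if $Y$ is nonempty and $\tau:Y\to\mathbf A^*(W)$, where $(\sigma\tau)(x)=\sigma(x)\tau$. (P3) $x\sigma=\sigma(x)$. (P4) $p\mapsto p\sigma$ is a homomorphism of Boolean algebras $\mathbf A_*(X)\to\mathbf A_*(Y)$. (P5) $(\forall x.p)\sigma=\forall y.(p\sigma^{y/x})$ whenever $y,z\in Y$, $y\ne z$ and $\sigma[z/y]=\sigma$.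 (Q1) $\forall x.(p\wedge q)=\forall x.p\wedge\forall x.q$. (Q2) $\forall x.p\le p$. (Q3) $\forall x.p=p$ if $p[y/x]=p$ for some $y\in X$, $y\neq x$. Notation: for $y\in Y$ and $d\in\mathbf A^*(Y)$, $[d/y]:Y\to\mathbf A^*(Y)$ sends $y$ to $d$ and every other variable to itself; for $d\in \mathbf A^*(Y)$, $\sigma^{d/x}:X\to\mathbf A^*(Y)$ sends $x$ to $d$ and agrees with $\sigma$ elsewhere. Supports. For nonempty $X$ and $t\in\mathbf A(X)$, a subset $U\subseteq X$ is a support for $t$ if $t\sigma=t\tau$ for all $Y$ and all $\sigma,\tau:X\to\mathbf A^*(Y)$ with $\sigma|_U=\tau|_U$; $t$ is closed if $\emptyset$ is a support for $t$ (elements of $\mathbf A(\emptyset)$ are by definition closed). $\mathbf A$ is locally finite if every element of every $\mathbf A(X)$ has a finite support. Standing convention: every quantifier theory considered is nontrivial, meaning that $\mathbf A_*(X)$ has a non-closed element for some nonempty $X\in\mathcal S$. Equality. An equality $e$ of $\mathbf A$ consists of an element $e(a,b)\in\mathbf A_*(X)$ for all $X$ and $a,b\in\mathbf A^*(X)$ such that (E1) $e(a,b)\sigma=e(a\sigma,b\sigma)$ for $X$ nonempty, $\sigma:X\to\mathbf A^*(Y)$; (E2) $e(a,a)=1$; (E3) $p\wedge e(x,y)\le p[x/y]$ for $x,y\in X$, $p\in\mathbf A_*(X)$. A quantifier theory with equality is a quantifier theory together with an equality. Models. A quantifier model is a quantifier theory $\mathbf B$ over a collection containing $\emptyset$ such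 that (M1) $\mathbf B^*(\emptyset)\neq\emptyset$ and $\mathbf B_*(\emptyset)$ is a nontrivial Boolean algebra ($0\ne1$); (M2) for nonempty $X$, $x\in X$, $p\in\mathbf B_*(X)$, $\sigma:X\to\mathbf B^*(\emptyset)$, the infimum $\bigwedge_{d\in\mathbf B^*(\emptyset)}p\sigma^{d/x}$ exists in $\mathbf B_*(\emptyset)$ and equals $(\forall x.p)\sigma$. It is a $2$-model if $\mathbf B_*(\emptyset)=2=\{0,1\}$. A modification (resp. model, $2$-model) of $\mathbf A$ is a quantifier theory (resp. quantifier model, $2$-model) over $\mathcal S\cup\{\emptyset\}$ whose restriction to $\mathcal S\setminus\{\emptyset\}$ equals that of $\mathbf A$ (including the equality when $\mathbf A$ has one). A quantifier model with equality is normal if (M3) for $a,b\in\mathbf B^*(\emptyset)$, $e(a,a)=1$ and $e(a,b)=0$ if $a\neq b$. Quotients. For a filter $I$ of $\mathbf B_*(\emptyset)$, $\mathbf B/I$ agrees with $\mathbf B$ except that its Boolean algebra at $\emptyset$ is $\mathbf B_*(\emptyset)/I$, with $p\sigma$ replaced by its class; for an ultrafilter the quotient is identified with $2$. In the claim, the equality of $\mathbf B$ at $\emptyset$ is $e(a,b)(i)=e(a(i),b(i))$, and that of $\mathbf B/I$ is its class modulo $I$. For a $2$-model $\mathbf C$ of $\mathbf A$ with equality and $a\,\theta\,b\iff e(a,b)=1$ on $\mathbf C^*(\emptyset)$, $\mathbf C/\theta$ is the modification of $\mathbf A$ with $(\mathbf C/\theta)_*(\emptyset)=\mathbf C_*(\emptyset)$,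 $(\mathbf C/\theta)^*(\emptyset)=\mathbf C^*(\emptyset)/\theta$, where for $\bar\sigma:X\to\mathbf C^*(\emptyset)/\theta$ and any lift $\sigma:X\to\mathbf C^*(\emptyset)$ of $\bar\sigma$ one sets $p\bar\sigma=p\sigma$ and $a\bar\sigma=$ the class of $a\sigma$ (these do not depend on the lift), and $e$ of two classes is $e$ of representatives. -}

module Defs where

open import Algebra.Lattice.Bundles using (BooleanAlgebra)
import Algebra.Lattice.Properties.BooleanAlgebra as BooleanAlgebraProperties
open import Algebra.Lattice.Morphism.Structures using (module LatticeMorphisms)
open import Data.Bool.Base using (if_then_else_)
open import Data.Empty using (⊥-elim; ⊥-elim-irr)
import Data.Empty.Polymorphic as Empty
open import Data.List.Base using (List; [])
open import Data.List.Membership.Propositional using (_∈_)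
import Data.List.Relation.Unary.Enumerates.Setoid as Enumerates
open import Data.Irrelevant using ([_])
open import Data.Maybe.Base using (Maybe; just; nothing)
open import Data.Product.Base using (_×_; _,_; Σ-syntax; ∃-syntax)
open import Data.Refinement using (Refinement-syntax; value; _,_)
open import Data.Sum.Base using (_⊎_)
open import Level using (Level; suc; _⊔_)
open import Relation.Binary.Core using (Rel)
open import Relation.Binary.Definitions using (DecidableEquality)
open import Relation.Binary.Structures using (IsEquivalence)
open import Relation.Binary.PropositionalEquality.Core using (_≢_)
open import Relation.Binary.PropositionalEquality.Properties using (setoid)
import Relation.Binary.Construct.NaturalOrder.Left as NaturalOrder
import Relation.Binary.Reasoning.Setoid as ≈-Reasoning
open import Relation.Nullary.Decidable.Core using (does)
open import Relation.Nullary.Negation.Core using (¬_)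
open import Relation.Unary using (Pred; ∅)

private
  variable
    a s ℓ : Level

------------------------------------------------------------------------
-- Sets

-- A is not the empty set.  Proofs of this are only ever used
-- irrelevantly, so that no operation can depend on which one it is given.
record NonEmpty (A : Set a) : Set a where
  field
    nonEmpty : ¬ ¬ A

Finite : Set a → Set a
Finite A = ∃[ xs ] Enumerates.IsEnumeration (setoid A) xs

Infinite : Set a → Set a
Infinite A = ¬ Finite A

------------------------------------------------------------------------
-- Boolean algebras

module _ (B : BooleanAlgebra ℓ ℓ) where
  open BooleanAlgebra B renaming (¬_ to ∁_)
  open NaturalOrder _≈_ _∧_ using (_≤_)

  IsInfimum : {D : Set ℓ} → (D → Carrier) → Carrier → Set ℓ
  IsInfimum f m = (∀ d → m ≤ f d) × (∀ q → (∀ d → q ≤ f d) → q ≤ m)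

  IsNontrivial : Set ℓ
  IsNontrivial = ¬ (⊥ ≈ ⊤)

  IsTwo : Set ℓ
  IsTwo = IsNontrivial × (∀ p → p ≈ ⊥ ⊎ p ≈ ⊤)

  record Filter : Set (suc ℓ) where
    field
      Mem      : Pred Carrier ℓ
      ⊤-mem    : Mem ⊤
      ∧-mem    : ∀ {p q} → Mem p → Mem q → Mem (p ∧ q)
      ≤-closed : ∀ {p q} → p ≤ q → Mem p → Mem q

  record IsUltrafilter (I : Filter) : Set ℓ where
    open Filter I
    field
      proper : ¬ Mem ⊥
      ultra  : ∀ p → Mem p ⊎ Mem (∁ p)

record IsBooleanHomomorphism (B C : BooleanAlgebra ℓ ℓ)
  (f : BooleanAlgebra.Carrier B → BooleanAlgebra.Carrier C) : Set ℓ where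
  private
    module B = BooleanAlgebra B
    module C = BooleanAlgebra C
  open LatticeMorphisms B.rawLattice C.rawLattice using (IsLatticeHomomorphism)
  field
    isLatticeHomomorphism : IsLatticeHomomorphism f
    ¬-homo                : ∀ p → f (B.¬ p) C.≈ C.¬ f p
    ⊤-homo                : f B.⊤ C.≈ C.⊤
    ⊥-homo                : f B.⊥ C.≈ C.⊥

module _ {𝓘 : Set ℓ} (B : 𝓘 → BooleanAlgebra ℓ ℓ) where
  private
    module B i = BooleanAlgebra (B i)

  ∏ᴮ : BooleanAlgebra ℓ ℓ
  ∏ᴮ = record
    { Carrier = ∀ i → B.Carrier i
    ; _≈_     = λ p q → ∀ i → B._≈_ i (p i) (q i)
    ; _∨_     = λ p q i → B._∨_ i (p i) (q i)
    ; _∧_     = λ p q i → B._∧_ i (p i) (q i)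
    ; ¬_      = λ p i → B.¬_ i (p i)
    ; ⊤       = λ i → B.⊤ i
    ; ⊥       = λ i → B.⊥ i
    ; isBooleanAlgebra = record
      { isDistributiveLattice = record
        { isLattice = record
          { isEquivalence = record
            { refl  = λ i → B.refl i
            ; sym   = λ e i → B.sym i (e i)
            ; trans = λ e f i → B.trans i (e i) (f i)
            }
          ; ∨-comm     = λ p q i → B.∨-comm i (p i) (q i)
          ; ∨-assoc    = λ p q r i → B.∨-assoc i (p i) (q i) (r i)
          ; ∨-cong     = λ e f i → B.∨-cong i (e i) (f i)
          ; ∧-comm     = λ p q i → B.∧-comm i (p i) (q i)
          ; ∧-assoc    = λ p q r i → B.∧-assoc i (p i) (q i) (r i)
          ; ∧-cong     = λ e f i → B.∧-cong i (e i) (f i)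
          ; absorptive = (λ p q i → B.∨-absorbs-∧ i (p i) (q i))
                       , (λ p q i → B.∧-absorbs-∨ i (p i) (q i))
          }
        ; ∨-distrib-∧ = (λ p q r i → B.∨-distribˡ-∧ i (p i) (q i) (r i))
                      , (λ p q r i → B.∨-distribʳ-∧ i (p i) (q i) (r i))
        ; ∧-distrib-∨ = (λ p q r i → B.∧-distribˡ-∨ i (p i) (q i) (r i))
                      , (λ p q r i → B.∧-distribʳ-∨ i (p i) (q i) (r i))
        }
      ; ∨-complement = (λ p i → B.∨-complementˡ i (p i))
                     , (λ p i → B.∨-complementʳ i (p i))
      ; ∧-complement = (λ p i → B.∧-complementˡ i (p i))
                     , (λ p i → B.∧-complementʳ i (p i))
      ; ¬-cong       = λ e i → B.¬-cong i (e i)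
      }
    }

module _ (B : BooleanAlgebra ℓ ℓ) (I : Filter B) where
  open BooleanAlgebra B renaming (¬_ to ∁_)
  open BooleanAlgebraProperties B using (deMorgan₁; ∨-identityʳ)
  open Filter I
  open ≈-Reasoning (BooleanAlgebra.setoid B)

  private
    infix 4 _∼_

    _∼_ : Rel Carrier ℓ
    p ∼ q = ∃[ h ] (Mem h × p ∧ h ≈ q ∧ h)

    ≈⇒∼ : ∀ {p q} → p ≈ q → p ∼ q
    ≈⇒∼ e = ⊤ , ⊤-mem , ∧-congʳ e

    shrinkʳ : ∀ {p q h} k → p ∧ h ≈ q ∧ h → p ∧ (h ∧ k) ≈ q ∧ (h ∧ k)
    shrinkʳ {p} {q} {h} k e = begin
      p ∧ (h ∧ k)  ≈⟨ ∧-assoc p h k ⟨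
      (p ∧ h) ∧ k  ≈⟨ ∧-congʳ e ⟩
      (q ∧ h) ∧ k  ≈⟨ ∧-assoc q h k ⟩
      q ∧ (h ∧ k)  ∎

    shrinkˡ : ∀ {p q k} h → p ∧ k ≈ q ∧ k → p ∧ (h ∧ k) ≈ q ∧ (h ∧ k)
    shrinkˡ {p} {q} {k} h e = begin
      p ∧ (h ∧ k)  ≈⟨ ∧-congˡ (∧-comm h k) ⟩
      p ∧ (k ∧ h)  ≈⟨ shrinkʳ h e ⟩
      q ∧ (k ∧ h)  ≈⟨ ∧-congˡ (∧-comm k h) ⟩
      q ∧ (h ∧ k)  ∎

    common : ∀ {p q p′ q′} → p ∼ q → p′ ∼ q′ →
             ∃[ h ] (Mem h × p ∧ h ≈ q ∧ h × p′ ∧ h ≈ q′ ∧ h)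
    common (h , h∈ , e) (k , k∈ , f) =
      h ∧ k , ∧-mem h∈ k∈ , shrinkʳ k e , shrinkˡ h f

    ∼-trans : ∀ {p q r} → p ∼ q → q ∼ r → p ∼ r
    ∼-trans u v with common u v
    ... | h , h∈ , e , f = h , h∈ , trans e f

    ∨-cong-∼ : ∀ {p q p′ q′} → p ∼ q → p′ ∼ q′ → p ∨ p′ ∼ q ∨ q′
    ∨-cong-∼ {p} {q} {p′} {q′} u v with common u v
    ... | h , h∈ , e , f = h , h∈ , (begin
      (p ∨ p′) ∧ h      ≈⟨ ∧-distribʳ-∨ h p p′ ⟩
      p ∧ h ∨ p′ ∧ h    ≈⟨ ∨-cong e f ⟩
      q ∧ h ∨ q′ ∧ h    ≈⟨ ∧-distribʳ-∨ h q q′ ⟨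
      (q ∨ q′) ∧ h      ∎)

    ∧-cong-∼ : ∀ {p q p′ q′} → p ∼ q → p′ ∼ q′ → p ∧ p′ ∼ q ∧ q′
    ∧-cong-∼ {p} {q} {p′} {q′} u v with common u v
    ... | h , h∈ , e , f = h , h∈ , (begin
      (p ∧ p′) ∧ h  ≈⟨ ∧-assoc p p′ h ⟩
      p ∧ (p′ ∧ h)  ≈⟨ ∧-congˡ f ⟩
      p ∧ (q′ ∧ h)  ≈⟨ shrinkˡ q′ e ⟩
      q ∧ (q′ ∧ h)  ≈⟨ ∧-assoc q q′ h ⟨
      (q ∧ q′) ∧ h  ∎)

    relative : ∀ p h → ∁ p ∧ h ≈ ∁ (p ∧ h) ∧ h
    relative p h = begin
      ∁ p ∧ h              ≈⟨ ∨-identityʳ _ ⟨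
      ∁ p ∧ h ∨ ⊥          ≈⟨ ∨-congˡ (∧-complementˡ h) ⟨
      ∁ p ∧ h ∨ ∁ h ∧ h    ≈⟨ ∧-distribʳ-∨ h (∁ p) (∁ h) ⟨
      (∁ p ∨ ∁ h) ∧ h      ≈⟨ ∧-congʳ (deMorgan₁ p h) ⟨
      ∁ (p ∧ h) ∧ h        ∎

    ∁-cong-∼ : ∀ {p q} → p ∼ q → ∁ p ∼ ∁ q
    ∁-cong-∼ {p} {q} (h , h∈ , e) = h , h∈ , (begin
      ∁ p ∧ h        ≈⟨ relative p h ⟩
      ∁ (p ∧ h) ∧ h  ≈⟨ ∧-congʳ (¬-cong e) ⟩
      ∁ (q ∧ h) ∧ h  ≈⟨ relative q h ⟨
      ∁ q ∧ h        ∎)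

  -- The same carrier and operations, with p and q identified when they
  -- agree on some member of I.
  _/ᴮ_ : BooleanAlgebra ℓ ℓ
  _/ᴮ_ = record
    { Carrier = Carrier
    ; _≈_     = _∼_
    ; _∨_     = _∨_
    ; _∧_     = _∧_
    ; ¬_      = ∁_
    ; ⊤       = ⊤
    ; ⊥       = ⊥
    ; isBooleanAlgebra = record
      { isDistributiveLattice = record
        { isLattice = record
          { isEquivalence = record
            { refl  = ≈⇒∼ refl
            ; sym   = λ (h , h∈ , e) → h , h∈ , sym e
            ; trans = ∼-trans
            }
          ; ∨-comm     = λ p q → ≈⇒∼ (∨-comm p q)
          ; ∨-assoc    = λ p q r → ≈⇒∼ (∨-assoc p q r)
          ; ∨-cong     = ∨-cong-∼
          ; ∧-comm     = λ p q → ≈⇒∼ (∧-comm p q)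
          ; ∧-assoc    = λ p q r → ≈⇒∼ (∧-assoc p q r)
          ; ∧-cong     = ∧-cong-∼
          ; absorptive = (λ p q → ≈⇒∼ (∨-absorbs-∧ p q))
                       , (λ p q → ≈⇒∼ (∧-absorbs-∨ p q))
          }
        ; ∨-distrib-∧ = (λ p q r → ≈⇒∼ (∨-distribˡ-∧ p q r))
                      , (λ p q r → ≈⇒∼ (∨-distribʳ-∧ p q r))
        ; ∧-distrib-∨ = (λ p q r → ≈⇒∼ (∧-distribˡ-∨ p q r))
                      , (λ p q r → ≈⇒∼ (∧-distribʳ-∨ p q r))
        }
      ; ∨-complement = (λ p → ≈⇒∼ (∨-complementˡ p))
                     , (λ p → ≈⇒∼ (∨-complementʳ p))
      ; ∧-complement = (λ p → ≈⇒∼ (∧-complementˡ p))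
                     , (λ p → ≈⇒∼ (∧-complementʳ p))
      ; ¬-cong       = ∁-cong-∼
      }
    }

------------------------------------------------------------------------
-- Collections of sets of variables

-- Decidable equality of variables is automatic classically; it is what
-- makes the substitutions [d/y] and σ^{d/x} definable by cases.
record Collection s ℓ : Set (suc (s ⊔ ℓ)) where
  infix 4 _≟_
  field
    Index    : Set s
    Var      : Index → Set ℓ
    _≟_      : ∀ {X} → DecidableEquality (Var X)
    infinite : ∃[ X ] Infinite (Var X)

  -- σ ⟪ d / x ⟫ is σ^{d/x}.
  _⟪_/_⟫ : ∀ {X} {D : Set ℓ} → (Var X → D) → D → Var X → (Var X → D)
  (σ ⟪ d / x ⟫) y = if does (y ≟ x) then d else σ y

-- (𝒮 ∖ {∅}) ∪ {∅}, where ∅ may or may not already belong to 𝒮.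
module _ (𝒮 : Collection s ℓ) where
  open Collection 𝒮

  Index∅ : Set (s ⊔ ℓ)
  Index∅ = Maybe [ X ∈ Index ∣ NonEmpty (Var X) ]

  Var∅ : Index∅ → Set ℓ
  Var∅ (just X) = Var (value X)
  Var∅ nothing  = Empty.⊥

  private
    _≟∅_ : ∀ {X} → DecidableEquality (Var∅ X)
    _≟∅_ {just X}  = _≟_
    _≟∅_ {nothing} = λ ()

    infinite⇒nonEmpty : ∀ {A : Set ℓ} → Infinite A → NonEmpty A
    infinite⇒nonEmpty inf = record
      { nonEmpty = λ empty → inf ([] , λ x → ⊥-elim (empty x)) }

    infinite∅ : ∃[ X ] Infinite (Var∅ X)
    infinite∅ with infinite
    ... | X , inf = just (X , [ infinite⇒nonEmpty inf ]) , inf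

  _∪∅ : Collection (s ⊔ ℓ) ℓ
  _∪∅ = record
    { Index    = Index∅
    ; Var      = Var∅
    ; _≟_      = λ {X} → _≟∅_ {X}
    ; infinite = infinite∅
    }

------------------------------------------------------------------------
-- Quantifier theories

-- The data of a quantifier theory.  Term X is 𝐀^*(X) and Form X is
-- 𝐀_*(X); equality on each is an explicit relation.
record RawTheory (𝒮 : Collection s ℓ) : Set (s ⊔ suc ℓ) where
  open Collection 𝒮 public

  field
    Term : Index → Set ℓ
    Eqᵗ  : ∀ X → Rel (Term X) ℓ
    Form : Index → BooleanAlgebra ℓ ℓ

  module Form X = BooleanAlgebra (Form X)

  ∣Form∣ : Index → Set ℓ
  ∣Form∣ X = Form.Carrier X

  infixl 9 _·ᵗ_ _·ᶠ_
  field
    var  : ∀ {X} → Var X → Term X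
    _·ᵗ_ : ∀ {X Y} .{{_ : NonEmpty (Var X)}} → Term X → (Var X → Term Y) → Term Y
    _·ᶠ_ : ∀ {X Y} .{{_ : NonEmpty (Var X)}} → ∣Form∣ X → (Var X → Term Y) → ∣Form∣ Y
    all  : ∀ {X} → Var X → ∣Form∣ X → ∣Form∣ X

  infix 4 _≈ᵗ_ _≈ᶠ_ _≤ᶠ_ _≈ˢ_
  infixr 7 _∧ᶠ_
  infixl 9 _∙_

  _≈ᵗ_ : ∀ {X} → Rel (Term X) ℓ
  _≈ᵗ_ {X} = Eqᵗ X

  _≈ᶠ_ : ∀ {X} → Rel (∣Form∣ X) ℓ
  _≈ᶠ_ {X} = Form._≈_ X

  _∧ᶠ_ : ∀ {X} → ∣Form∣ X → ∣Form∣ X → ∣Form∣ X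
  _∧ᶠ_ {X} = Form._∧_ X

  _≤ᶠ_ : ∀ {X} → Rel (∣Form∣ X) ℓ
  _≤ᶠ_ {X} = NaturalOrder._≤_ (Form._≈_ X) (Form._∧_ X)

  _≈ˢ_ : ∀ {X Y} → Rel (Var X → Term Y) ℓ
  σ ≈ˢ τ = ∀ x → σ x ≈ᵗ τ x

  _∙_ : ∀ {X Y W} .{{_ : NonEmpty (Var Y)}} →
        (Var X → Term Y) → (Var Y → Term W) → (Var X → Term W)
  (σ ∙ τ) x = σ x ·ᵗ τ

  -- [ d / y ] sends y to d and every other variable to itself.
  [_/_] : ∀ {Y} → Term Y → Var Y → (Var Y → Term Y)
  [ d / y ] = var ⟪ d / y ⟫

  module _ {X} .{{_ : NonEmpty (Var X)}} where

    AgreeOn : ∀ {u Y} → Pred (Var X) u → Rel (Var X → Term Y) (u ⊔ ℓ)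
    AgreeOn U σ τ = ∀ {x} → U x → σ x ≈ᵗ τ x

    IsSupportᵗ : ∀ {u} → Pred (Var X) u → Term X → Set (u ⊔ s ⊔ ℓ)
    IsSupportᵗ U t = ∀ {Y} (σ τ : Var X → Term Y) → AgreeOn U σ τ → t ·ᵗ σ ≈ᵗ t ·ᵗ τ

    IsSupportᶠ : ∀ {u} → Pred (Var X) u → ∣Form∣ X → Set (u ⊔ s ⊔ ℓ)
    IsSupportᶠ U p = ∀ {Y} (σ τ : Var X → Term Y) → AgreeOn U σ τ → p ·ᶠ σ ≈ᶠ p ·ᶠ τ

    Closedᶠ : ∣Form∣ X → Set (s ⊔ ℓ)
    Closedᶠ = IsSupportᶠ ∅

  -- For empty X every element is closed, so there is nothing to require.
  record LocallyFinite : Set (s ⊔ ℓ) where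
    field
      finiteSupportᵗ : ∀ {X} .{{_ : NonEmpty (Var X)}} (t : Term X) →
                       Σ[ U ∈ List (Var X) ] IsSupportᵗ (_∈ U) t
      finiteSupportᶠ : ∀ {X} .{{_ : NonEmpty (Var X)}} (p : ∣Form∣ X) →
                       Σ[ U ∈ List (Var X) ] IsSupportᶠ (_∈ U) p

record IsQuantifierTheory {𝒮 : Collection s ℓ} (T : RawTheory 𝒮) : Set (s ⊔ ℓ) where
  open RawTheory T
  field
    ≈ᵗ-isEquivalence : ∀ {X} → IsEquivalence (Eqᵗ X)
    ·ᵗ-cong : ∀ {X Y} .{{_ : NonEmpty (Var X)}} {a b : Term X} {σ τ : Var X → Term Y} →
              a ≈ᵗ b → σ ≈ˢ τ → a ·ᵗ σ ≈ᵗ b ·ᵗ τ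
    ·ᶠ-cong : ∀ {X Y} .{{_ : NonEmpty (Var X)}} {p q : ∣Form∣ X} {σ τ : Var X → Term Y} →
              p ≈ᶠ q → σ ≈ˢ τ → p ·ᶠ σ ≈ᶠ q ·ᶠ τ
    all-cong : ∀ {X} (x : Var X) {p q : ∣Form∣ X} → p ≈ᶠ q → all x p ≈ᶠ all x q

    P1ᵗ : ∀ {X} .{{_ : NonEmpty (Var X)}} (t : Term X) → t ·ᵗ var ≈ᵗ t
    P1ᶠ : ∀ {X} .{{_ : NonEmpty (Var X)}} (p : ∣Form∣ X) → p ·ᶠ var ≈ᶠ p
    P2ᵗ : ∀ {X Y W} .{{_ : NonEmpty (Var X)}} .{{_ : NonEmpty (Var Y)}}
          (t : Term X) (σ : Var X → Term Y) (τ : Var Y → Term W) →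
          (t ·ᵗ σ) ·ᵗ τ ≈ᵗ t ·ᵗ (σ ∙ τ)
    P2ᶠ : ∀ {X Y W} .{{_ : NonEmpty (Var X)}} .{{_ : NonEmpty (Var Y)}}
          (p : ∣Form∣ X) (σ : Var X → Term Y) (τ : Var Y → Term W) →
          (p ·ᶠ σ) ·ᶠ τ ≈ᶠ p ·ᶠ (σ ∙ τ)
    P3  : ∀ {X Y} .{{_ : NonEmpty (Var X)}} (x : Var X) (σ : Var X → Term Y) →
          var x ·ᵗ σ ≈ᵗ σ x
    P4  : ∀ {X Y} .{{_ : NonEmpty (Var X)}} (σ : Var X → Term Y) →
          IsBooleanHomomorphism (Form X) (Form Y) (_·ᶠ σ)
    P5  : ∀ {X Y} .{{_ : NonEmpty (Var X)}} .{{_ : NonEmpty (Var Y)}}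
          (x : Var X) (p : ∣Form∣ X) (σ : Var X → Term Y) (y z : Var Y) →
          y ≢ z → σ ∙ [ var z / y ] ≈ˢ σ →
          all x p ·ᶠ σ ≈ᶠ all y (p ·ᶠ (σ ⟪ var y / x ⟫))

    Q1  : ∀ {X} (x : Var X) (p q : ∣Form∣ X) → all x (p ∧ᶠ q) ≈ᶠ all x p ∧ᶠ all x q
    Q2  : ∀ {X} (x : Var X) (p : ∣Form∣ X) → all x p ≤ᶠ p
    Q3  : ∀ {X} .{{_ : NonEmpty (Var X)}} (x y : Var X) (p : ∣Form∣ X) →
          y ≢ x → p ·ᶠ [ var y / x ] ≈ᶠ p → all x p ≈ᶠ p

    -- Quantifier theories are nontrivial by convention.
    nontrivial : ∃[ X ] Σ[ ne ∈ NonEmpty (Var X) ] ∃[ p ] ¬ Closedᶠ {X} {{ne}} p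

RawEquality : {𝒮 : Collection s ℓ} → RawTheory 𝒮 → Set (s ⊔ ℓ)
RawEquality T = ∀ X → Term X → Term X → ∣Form∣ X
  where open RawTheory T

record IsEquality {𝒮 : Collection s ℓ} (T : RawTheory 𝒮) (e : RawEquality T) : Set (s ⊔ ℓ) where
  open RawTheory T
  field
    e-cong : ∀ {X} {a a′ b b′ : Term X} → a ≈ᵗ a′ → b ≈ᵗ b′ → e X a b ≈ᶠ e X a′ b′
    E1 : ∀ {X Y} .{{_ : NonEmpty (Var X)}} (a b : Term X) (σ : Var X → Term Y) →
         e X a b ·ᶠ σ ≈ᶠ e Y (a ·ᵗ σ) (b ·ᵗ σ)
    E2 : ∀ {X} (a : Term X) → e X a a ≈ᶠ Form.⊤ X
    E3 : ∀ {X} .{{_ : NonEmpty (Var X)}} (x y : Var X) (p : ∣Form∣ X) →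
         p ∧ᶠ e X (var x) (var y) ≤ᶠ p ·ᶠ [ var x / y ]

record QuantifierTheoryWithEquality (𝒮 : Collection s ℓ) : Set (s ⊔ suc ℓ) where
  field
    theory             : RawTheory 𝒮
    isQuantifierTheory : IsQuantifierTheory theory
    e                  : RawEquality theory
    isEquality         : IsEquality theory e

  open RawTheory theory public

------------------------------------------------------------------------
-- Models

record IsQuantifierModel {𝒮 : Collection s ℓ} (T : RawTheory 𝒮)
  (O : Collection.Index 𝒮) : Set (s ⊔ ℓ) where
  open RawTheory T
  field
    O-empty            : ¬ Var O
    isQuantifierTheory : IsQuantifierTheory T
    M1ᵗ : NonEmpty (Term O)
    M1ᶠ : IsNontrivial (Form O)
    M2  : ∀ {X} .{{_ : NonEmpty (Var X)}} (x : Var X) (p : ∣Form∣ X) (σ : Var X → Term O) →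
          IsInfimum (Form O) (λ d → p ·ᶠ (σ ⟪ d / x ⟫)) (all x p ·ᶠ σ)

record IsNormal {𝒮 : Collection s ℓ} (T : RawTheory 𝒮) (e : RawEquality T)
  (O : Collection.Index 𝒮) : Set ℓ where
  open RawTheory T
  field
    M3-equal   : ∀ (a : Term O) → e O a a ≈ᶠ Form.⊤ O
    M3-unequal : ∀ (a b : Term O) → ¬ (a ≈ᵗ b) → e O a b ≈ᶠ Form.⊥ O

module _ {𝒮 : Collection s ℓ} (𝐀 : QuantifierTheoryWithEquality 𝒮) where
  private
    module A = QuantifierTheoryWithEquality 𝐀

  -- A theory over 𝒮 ∪ {∅} restricting to 𝐀 on 𝒮 ∖ {∅} is determined by
  -- what it has at ∅, since variables, quantifiers and substitution out
  -- of X only concern nonempty X.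
  record Fibre : Set (s ⊔ suc ℓ) where
    field
      Term∅ : Set ℓ
      Eqᵗ∅  : Rel Term∅ ℓ
      Form∅ : BooleanAlgebra ℓ ℓ
      subᵗ  : ∀ {X} .{{_ : NonEmpty (A.Var X)}} → A.Term X → (A.Var X → Term∅) → Term∅
      subᶠ  : ∀ {X} .{{_ : NonEmpty (A.Var X)}} → A.∣Form∣ X → (A.Var X → Term∅) →
              BooleanAlgebra.Carrier Form∅
      e∅    : Term∅ → Term∅ → BooleanAlgebra.Carrier Form∅

  module _ (F : Fibre) where
    open Fibre F

    private
      Var′ : Index∅ 𝒮 → Set ℓ
      Var′ = Var∅ 𝒮

      Term′ : Index∅ 𝒮 → Set ℓ
      Term′ (just X) = A.Term (value X)
      Term′ nothing  = Term∅

      Eqᵗ′ : ∀ X → Rel (Term′ X) ℓ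
      Eqᵗ′ (just X) = A.Eqᵗ (value X)
      Eqᵗ′ nothing  = Eqᵗ∅

      Form′ : Index∅ 𝒮 → BooleanAlgebra ℓ ℓ
      Form′ (just X) = A.Form (value X)
      Form′ nothing  = Form∅

      ∣Form′∣ : Index∅ 𝒮 → Set ℓ
      ∣Form′∣ X = BooleanAlgebra.Carrier (Form′ X)

      absurd : ∀ {C : Set ℓ} → .(NonEmpty (Var′ nothing)) → C
      absurd ne = ⊥-elim-irr (NonEmpty.nonEmpty ne λ ())

      var′ : ∀ X → Var′ X → Term′ X
      var′ (just X) = A.var
      var′ nothing ()

      subᵗ′ : ∀ X Y → .(NonEmpty (Var′ X)) → Term′ X → (Var′ X → Term′ Y) → Term′ Y
      subᵗ′ (just X) (just Y) ne = A._·ᵗ_ {{ne}}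
      subᵗ′ (just X) nothing  ne = subᵗ {{ne}}
      subᵗ′ nothing  Y        ne = absurd ne

      subᶠ′ : ∀ X Y → .(NonEmpty (Var′ X)) → ∣Form′∣ X → (Var′ X → Term′ Y) → ∣Form′∣ Y
      subᶠ′ (just X) (just Y) ne = A._·ᶠ_ {{ne}}
      subᶠ′ (just X) nothing  ne = subᶠ {{ne}}
      subᶠ′ nothing  Y        ne = absurd ne

      all′ : ∀ X → Var′ X → ∣Form′∣ X → ∣Form′∣ X
      all′ (just X) = A.all
      all′ nothing ()

      e′ : ∀ X → Term′ X → Term′ X → ∣Form′∣ X
      e′ (just X) = A.e (value X)
      e′ nothing  = e∅

    extend : RawTheory (𝒮 ∪∅)
    extend = record
      { Term = Term′
      ; Eqᵗ  = Eqᵗ′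
      ; Form = Form′
      ; var  = λ {X} → var′ X
      ; _·ᵗ_ = λ {X} {Y} {{ne}} → subᵗ′ X Y ne
      ; _·ᶠ_ = λ {X} {Y} {{ne}} → subᶠ′ X Y ne
      ; all  = λ {X} → all′ X
      }

    extendᵉ : RawEquality extend
    extendᵉ = e′

    record IsNormalTwoModel : Set (s ⊔ ℓ) where
      field
        isQuantifierModel : IsQuantifierModel extend nothing
        isTwo             : IsTwo Form∅
        isEquality        : IsEquality extend extendᵉ
        isNormal          : IsNormal extend extendᵉ nothing

module _ {𝒮 : Collection s ℓ} {𝐀 : QuantifierTheoryWithEquality 𝒮} where

  ∏ : {𝓘 : Set ℓ} → (𝓘 → Fibre 𝐀) → Fibre 𝐀
  ∏ B = record
    { Term∅ = ∀ i → B.Term∅ i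
    ; Eqᵗ∅  = λ a b → ∀ i → B.Eqᵗ∅ i (a i) (b i)
    ; Form∅ = ∏ᴮ B.Form∅
    ; subᵗ  = λ a σ i → B.subᵗ i a (λ x → σ x i)
    ; subᶠ  = λ p σ i → B.subᶠ i p (λ x → σ x i)
    ; e∅    = λ a b i → B.e∅ i (a i) (b i)
    }
    where module B i = Fibre (B i)

  infixl 8 _/_
  infixl 8 _/θ

  _/_ : (B : Fibre 𝐀) → Filter (Fibre.Form∅ B) → Fibre 𝐀
  B / I = record
    { Term∅ = Term∅
    ; Eqᵗ∅  = Eqᵗ∅
    ; Form∅ = Form∅ /ᴮ I
    ; subᵗ  = subᵗ
    ; subᶠ  = subᶠ
    ; e∅    = e∅
    }
    where open Fibre B

  -- The relation Eqᵗ∅ becomes θ.  A substitution into the quotient is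
  -- represented by a lift; independence of the lift is the content of
  -- ·ᵗ-cong, ·ᶠ-cong and e-cong for the extended theory.
  _/θ : Fibre 𝐀 → Fibre 𝐀
  C /θ = record
    { Term∅ = Term∅
    ; Eqᵗ∅  = λ a b → BooleanAlgebra._≈_ Form∅ (e∅ a b) (BooleanAlgebra.⊤ Form∅)
    ; Form∅ = Form∅
    ; subᵗ  = subᵗ
    ; subᶠ  = subᶠ
    ; e∅    = e∅
    }
    where open Fibre C

{-# OPTIONS --safe #-}

-- Writing "eventually P" for "the set of i with P i belongs to I", equality of
-- forms of the ultraproduct is eventual equality, and by normality of the B i so
-- is θ on terms.  Every law other than the congruences and (M2) is then inherited
-- coordinatewise.  Congruence of substitution is where local finiteness
-- enters: σ θ τ gives one member of I per variable, and only the finitely many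
-- variables of a support matter.  For (M2), the infimum (∀x.p)σ is attained in
-- each B i because B i is a 2-model; choosing a witness in each coordinate gives a
-- single d with p σ^{d/x} = (∀x.p)σ.

module Submission where

open import Defs
open import Algebra.Lattice.Bundles using (BooleanAlgebra)
import Algebra.Lattice.Properties.BooleanAlgebra as BooleanAlgebraProperties
open import Algebra.Lattice.Morphism.Structures using (module LatticeMorphisms)
open import Axiom.DoubleNegationElimination using (em⇒dne)
open import Axiom.ExcludedMiddle using (ExcludedMiddle)
open import Data.Bool.Base using (true; false)
open import Data.Empty using (⊥-elim-irr)
open import Data.Irrelevant using ([_])
open import Data.List.Base using (List; []; _∷_)
open import Data.List.Membership.Propositional using (_∈_)
open import Data.List.Relation.Unary.Any using (here; there)
open import Data.Maybe.Base using (just; nothing)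
open import Data.Product.Base using (_×_; _,_; Σ-syntax; ∃-syntax; proj₁; proj₂)
open import Data.Refinement using (value; _,_)
open import Data.Sum.Base using (_⊎_; inj₁; inj₂)
open import Function.Base using (_∘_; const)
open import Relation.Binary.Bundles using (Setoid)
open import Relation.Binary.Core using (Rel)
open import Relation.Binary.Structures using (IsEquivalence)
import Relation.Binary.Reasoning.Setoid as ≈-Reasoning
open import Relation.Binary.PropositionalEquality using (_≡_; _≢_; refl; sym; cong)
open import Relation.Nullary using (yes; no; does; ¬_; contradiction)

-- Witnesses from excluded middle

module _ {ℓ} (em : ExcludedMiddle ℓ) where

  inhabitant : {A : Set ℓ} → .(NonEmpty A) → A
  inhabitant {A} ne with em {A}
  ... | yes a = a
  ... | no ¬a = ⊥-elim-irr (NonEmpty.nonEmpty ne ¬a)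

  -- Two distinct variables allow one substitution to take two prescribed values, as `·-const`
  -- requires.
  twoElements : {A : Set ℓ} → Infinite A → ∃[ x ] ∃[ y ] (x ≢ y)
  twoElements {A} inf = em⇒dne em λ none → inf (singleton none)
    where
    singleton : ¬ (∃[ x ] ∃[ y ] (x ≢ y)) → Finite A
    singleton none with em {A}
    ... | yes a = a ∷ [] , λ x → here (em⇒dne em λ x≢a → none (x , a , x≢a))
    ... | no ¬a = [] , λ x → contradiction x ¬a

-- Supports

module _ {s ℓ} (em : ExcludedMiddle ℓ) {𝒮 : Collection s ℓ} {T : RawTheory 𝒮}
  (isQT : IsQuantifierTheory T) where

  open RawTheory T
  open IsQuantifierTheory isQT

  private
    module ≈ᵗ {X} = IsEquivalence (≈ᵗ-isEquivalence {X})

  override-at : ∀ {X} {D : Set ℓ} (σ : Var X → D) d x → (σ ⟪ d / x ⟫) x ≡ d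
  override-at σ d x with x ≟ x
  ... | yes _  = refl
  ... | no x≢x = contradiction refl x≢x

  override-off : ∀ {X} {D : Set ℓ} (σ : Var X → D) d {x y} → y ≢ x → (σ ⟪ d / x ⟫) y ≡ σ y
  override-off σ d {x} {y} y≢x with y ≟ x
  ... | yes y≡x = contradiction y≡x y≢x
  ... | no _    = refl

  -- For `x₀` in `U` this is a retraction onto `U`; after precomposing with it, substitutions that
  -- agree on `U` agree everywhere.
  collapse : ∀ {X} → List (Var X) → Var X → Var X → Var X
  collapse U x₀ x with em {x ∈ U}
  ... | yes _ = x
  ... | no _  = x₀

  collapse-fix : ∀ {X} {U : List (Var X)} {x₀ x} → x ∈ U → collapse U x₀ x ≡ x
  collapse-fix {U = U} {x = x} x∈U with em {x ∈ U}
  ... | yes _  = refl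
  ... | no x∉U = contradiction x∈U x∉U

  collapse-∈ : ∀ {X} {U : List (Var X)} {x₀} → x₀ ∈ U → ∀ x → collapse U x₀ x ∈ U
  collapse-∈ {U = U} x₀∈U x with em {x ∈ U}
  ... | yes x∈U = x∈U
  ... | no _    = x₀∈U

  -- Stated for an abstract action so as to cover both terms and forms.
  module Action
    (Val : Index → Set ℓ) (_≈_ : ∀ {X} → Rel (Val X) ℓ)
    (isEquivalence : ∀ {X} → IsEquivalence (_≈_ {X}))
    (_·_ : ∀ {X Y} .{{_ : NonEmpty (Var X)}} → Val X → (Var X → Term Y) → Val Y)
    (·-congˡ : ∀ {X Y} .{{_ : NonEmpty (Var X)}} (t : Val X) {σ τ : Var X → Term Y} →
               σ ≈ˢ τ → (t · σ) ≈ (t · τ))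
    (·-congʳ : ∀ {X Y} .{{_ : NonEmpty (Var X)}} {t u : Val X} (σ : Var X → Term Y) →
               t ≈ u → (t · σ) ≈ (u · σ))
    (·-identity : ∀ {X} .{{_ : NonEmpty (Var X)}} (t : Val X) → (t · var) ≈ t)
    (·-assoc : ∀ {X Y W} .{{_ : NonEmpty (Var X)}} .{{_ : NonEmpty (Var Y)}}
               (t : Val X) (σ : Var X → Term Y) (τ : Var Y → Term W) →
               ((t · σ) · τ) ≈ (t · (σ ∙ τ)))
    where

    private
      module ≈ {X} = IsEquivalence (isEquivalence {X})

      setoid : Index → Setoid ℓ ℓ
      setoid X = record { isEquivalence = isEquivalence {X} }

    module _ {X} .{{ne : NonEmpty (Var X)}} (t : Val X) where

      ·-rename : ∀ {Y W} .{{_ : NonEmpty (Var Y)}} (f : Var X → Var Y) (σ : Var Y → Term W) →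
                 ((t · (var ∘ f)) · σ) ≈ (t · (σ ∘ f))
      ·-rename f σ = ≈.trans (·-assoc t (var ∘ f) σ) (·-congˡ t λ x → P3 (f x) σ)

      -- The hypothesis lives over the nonempty `X`, while `Y` may be empty: (P2) carries a fact
      -- about renaming within `X` to every target.
      ·-fixed : ∀ {Y} (f : Var X → Var X) (σ : Var X → Term Y) →
                (t · (var ∘ f)) ≈ (t · var) → (t · σ) ≈ (t · (σ ∘ f))
      ·-fixed f σ e = ≈.trans
        (·-congʳ σ (≈.sym (≈.trans e (·-identity t)))) (·-rename f σ)

      -- A closed t takes the same value at the constant substitutions by two
      -- distinct variables z₀ and z₁, hence at any two constant substitutions.
      ·-const : (∀ {Y} .{{_ : NonEmpty (Var Y)}} (σ τ : Var X → Term Y) → (t · σ) ≈ (t · τ)) →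
                ∀ {Y} (a b : Term Y) → (t · const a) ≈ (t · const b)
      ·-const closed a b with infinite
      ... | Z , inf with twoElements em inf
      ... | z₀ , z₁ , z₀≢z₁ = begin
        t · const a               ≈⟨ ·-congˡ t (λ _ → ≈ᵗ.reflexive (override-at ρ a z₀)) ⟨
        t · const (ρ′ z₀)         ≈⟨ ·-rename (const z₀) ρ′ ⟨
        (t · const (var z₀)) · ρ′ ≈⟨ ·-congʳ ρ′ (closed _ _) ⟩
        (t · const (var z₁)) · ρ′ ≈⟨ ·-rename (const z₁) ρ′ ⟩
        t · const (ρ′ z₁)         ≈⟨ ·-congˡ t (λ _ → ≈ᵗ.reflexive (override-off ρ a (z₀≢z₁ ∘ sym))) ⟩
        t · const b               ∎
        where
        open ≈-Reasoning (setoid _)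
        instance
          Z-nonEmpty : NonEmpty (Var Z)
          Z-nonEmpty = record { nonEmpty = λ empty → empty z₀ }
        ρ ρ′ : Var Z → Term _
        ρ  = const b
        ρ′ = ρ ⟪ a / z₀ ⟫

      -- A theory and its modifications differ only at the empty set, so this transfers supports
      -- between them. A renaming of `X` into itself that is the identity on `U` fixes `t`, so every
      -- substitution may be precomposed with one whose image lies in `U`, or with a constant one if
      -- `U` is empty.
      support-of-nonEmpty-targets :
        (U : List (Var X)) →
        (∀ {Y} .{{_ : NonEmpty (Var Y)}} (σ τ : Var X → Term Y) →
          AgreeOn (_∈ U) σ τ → (t · σ) ≈ (t · τ)) →
        ∀ {Y} (σ τ : Var X → Term Y) → AgreeOn (_∈ U) σ τ → (t · σ) ≈ (t · τ)
      support-of-nonEmpty-targets (u ∷ U) supp σ τ agree =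
        ≈.trans (collapsed σ)
          (≈.trans (·-congˡ t λ x → agree (collapse-∈ (here refl) x))
            (≈.sym (collapsed τ)))
        where
        collapsed : ∀ {Y} (σ : Var X → Term Y) → (t · σ) ≈ (t · (σ ∘ collapse (u ∷ U) u))
        collapsed σ = ·-fixed _ σ
          (supp _ var λ x∈U → ≈ᵗ.reflexive (cong var (collapse-fix x∈U)))
      support-of-nonEmpty-targets [] supp σ τ _ =
        -- There is no variable of `U` to collapse to. An arbitrary one is used instead; `σ` and `τ`
        -- may differ at it, which `·-const` repairs.
        ≈.trans (constant σ) (≈.trans (·-const closed _ _) (≈.sym (constant τ)))
        where
        closed : ∀ {Y} .{{_ : NonEmpty (Var Y)}} (σ τ : Var X → Term Y) → (t · σ) ≈ (t · τ)
        closed σ τ = supp σ τ λ ()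
        constant : ∀ {Y} (σ : Var X → Term Y) → (t · σ) ≈ (t · const (σ (inhabitant em ne)))
        constant σ = ·-fixed (const (inhabitant em ne)) σ (closed _ _)

  supportᵗ : ∀ {X} .{{_ : NonEmpty (Var X)}} (t : Term X) (U : List (Var X)) →
    (∀ {Y} .{{_ : NonEmpty (Var Y)}} (σ τ : Var X → Term Y) →
      AgreeOn (_∈ U) σ τ → t ·ᵗ σ ≈ᵗ t ·ᵗ τ) →
    IsSupportᵗ (_∈ U) t
  supportᵗ t U supp {Y} = Action.support-of-nonEmpty-targets
    Term _≈ᵗ_ ≈ᵗ-isEquivalence _·ᵗ_
    (λ _ → ·ᵗ-cong ≈ᵗ.refl) (λ _ t≈u → ·ᵗ-cong t≈u λ _ → ≈ᵗ.refl)
    P1ᵗ P2ᵗ t U supp {Y}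

  supportᶠ : ∀ {X} .{{_ : NonEmpty (Var X)}} (p : ∣Form∣ X) (U : List (Var X)) →
    (∀ {Y} .{{_ : NonEmpty (Var Y)}} (σ τ : Var X → Term Y) →
      AgreeOn (_∈ U) σ τ → p ·ᶠ σ ≈ᶠ p ·ᶠ τ) →
    IsSupportᶠ (_∈ U) p
  supportᶠ p U supp {Y} = Action.support-of-nonEmpty-targets
    ∣Form∣ _≈ᶠ_ (λ {X} → Form.isEquivalence X) _·ᶠ_
    (λ {X} _ → ·ᶠ-cong (Form.refl X)) (λ _ p≈q → ·ᶠ-cong p≈q λ _ → ≈ᵗ.refl)
    P1ᶠ P2ᶠ p U supp {Y}

-- Ultraproducts

module ReducedProduct {ℓ} {𝓘 : Set ℓ} (F : 𝓘 → BooleanAlgebra ℓ ℓ) (two : ∀ i → IsTwo (F i))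
  (I : Filter (∏ᴮ F)) where

  private
    module F i = BooleanAlgebra (F i)
    module P i = BooleanAlgebraProperties (F i)
    module ∏F = BooleanAlgebra (∏ᴮ F)
    module Q = BooleanAlgebra (∏ᴮ F /ᴮ I)
    open Filter I

  -- The factors being two-valued, `h` is a characteristic function. Asking for a member of `I`
  -- inside `P` spares turning `P` itself into an element of the product.
  Eventually : (𝓘 → Set ℓ) → Set ℓ
  Eventually P = ∃[ h ] (Mem h × (∀ i → F._≈_ i (h i) (F.⊤ i) → P i))

  always : ∀ {P} → (∀ i → P i) → Eventually P
  always p = ∏F.⊤ , ⊤-mem , λ i _ → p i

  eventually-map : ∀ {P R} → (∀ i → P i → R i) → Eventually P → Eventually R
  eventually-map f (h , h∈ , p) = h , h∈ , λ i → f i ∘ p i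

  eventually-× : ∀ {P R} → Eventually P → Eventually R → Eventually (λ i → P i × R i)
  eventually-× (h , h∈ , p) (k , k∈ , r) = (h ∏F.∧ k) , ∧-mem h∈ k∈ , λ i e →
    p i (⊤-factor i e) , r i (⊤-factor i (F.trans i (F.∧-comm i (k i) (h i)) e))
    where
    ⊤-factor : ∀ i {x y} → F._≈_ i (F._∧_ i x y) (F.⊤ i) → F._≈_ i x (F.⊤ i)
    ⊤-factor i {x} {y} e = begin
      x                       ≈⟨ F.∨-absorbs-∧ i x y ⟨
      F._∨_ i x (F._∧_ i x y) ≈⟨ F.∨-congˡ i e ⟩
      F._∨_ i x (F.⊤ i)       ≈⟨ P.∨-zeroʳ i x ⟩
      F.⊤ i                   ∎
      where open ≈-Reasoning (F.setoid i)

  -- A filter is closed under finite meets only, hence the restriction to the elements of a list.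
  eventually-∀∈ : ∀ {A : Set ℓ} {P : A → 𝓘 → Set ℓ} (U : List A) →
                  (∀ a → Eventually (P a)) → Eventually (λ i → ∀ a → a ∈ U → P a i)
  eventually-∀∈ []      p = always λ i a ()
  eventually-∀∈ (a ∷ U) p = eventually-map
    (λ { i (pa , pU) _ (here refl) → pa ; i (pa , pU) b (there b∈U) → pU b b∈U })
    (eventually-× (p a) (eventually-∀∈ U p))

  ≈⇒eventually : ∀ {p q} → p Q.≈ q → Eventually (λ i → F._≈_ i (p i) (q i))
  ≈⇒eventually {p} {q} (h , h∈ , e) = h , h∈ , equal
    where
    equal : ∀ i → F._≈_ i (h i) (F.⊤ i) → F._≈_ i (p i) (q i)
    equal i hi = begin
      p i                   ≈⟨ P.∧-identityʳ i (p i) ⟨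
      F._∧_ i (p i) (F.⊤ i) ≈⟨ F.∧-congˡ i hi ⟨
      F._∧_ i (p i) (h i)   ≈⟨ e i ⟩
      F._∧_ i (q i) (h i)   ≈⟨ F.∧-congˡ i hi ⟩
      F._∧_ i (q i) (F.⊤ i) ≈⟨ P.∧-identityʳ i (q i) ⟩
      q i                   ∎
      where open ≈-Reasoning (F.setoid i)

  -- The quotient compares `p ∧ h` with `q ∧ h` at every coordinate. Where `h` is not `⊤` it is `⊥`,
  -- by two-valuedness, and both meets vanish.
  eventually⇒≈ : ∀ {p q} → Eventually (λ i → F._≈_ i (p i) (q i)) → p Q.≈ q
  eventually⇒≈ {p} {q} (h , h∈ , f) = h , h∈ , agree
    where
    agree : ∀ i → F._≈_ i (F._∧_ i (p i) (h i)) (F._∧_ i (q i) (h i))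
    agree i with proj₂ (two i) (h i)
    ... | inj₂ h≈⊤ = F.∧-congʳ i (f i h≈⊤)
    ... | inj₁ h≈⊥ = F.trans i (vanish (p i)) (F.sym i (vanish (q i)))
      where
      vanish : ∀ x → F._≈_ i (F._∧_ i x (h i)) (F.⊥ i)
      vanish x = F.trans i (F.∧-congˡ i h≈⊥) (P.∧-zeroʳ i x)

  pointwise : ∀ {p q} → (∀ i → F._≈_ i (p i) (q i)) → p Q.≈ q
  pointwise e = eventually⇒≈ (always e)

-- Quotients by ultrafilters

module _ {ℓ} (B : BooleanAlgebra ℓ ℓ) (I : Filter B) (isUltrafilter : IsUltrafilter B I) where

  open BooleanAlgebra B renaming (¬_ to ∁_; sym to ≈-sym)
  open BooleanAlgebraProperties B using (∧-identityˡ; ∧-idem; ∧-zeroˡ)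
  open Filter I
  open IsUltrafilter isUltrafilter

  -- Whichever of `p` and `∁ p` lies in `I` is itself the member on which `p` agrees with `⊤` or
  -- with `⊥`.
  ultrafilter-isTwo : IsTwo (B /ᴮ I)
  ultrafilter-isTwo = proper-quotient , decide
    where
    proper-quotient : IsNontrivial (B /ᴮ I)
    proper-quotient (h , h∈ , e) = proper (≤-closed h≤⊥ h∈)
      where
      open ≈-Reasoning setoid
      h≤⊥ : h ≈ h ∧ ⊥
      h≤⊥ = begin
        h      ≈⟨ ∧-identityˡ h ⟨
        ⊤ ∧ h  ≈⟨ e ⟨
        ⊥ ∧ h  ≈⟨ ∧-comm ⊥ h ⟩
        h ∧ ⊥  ∎
    decide : ∀ p → BooleanAlgebra._≈_ (B /ᴮ I) p ⊥ ⊎ BooleanAlgebra._≈_ (B /ᴮ I) p ⊤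
    decide p with ultra p
    ... | inj₁ p∈  = inj₂ (p , p∈ , trans (∧-idem p) (≈-sym (∧-identityˡ p)))
    ... | inj₂ ∁p∈ = inj₁ (∁ p , ∁p∈ , trans (∧-complementʳ p) (≈-sym (∧-zeroˡ (∁ p))))

module _ {s ℓ} (em : ExcludedMiddle ℓ) {𝒮 : Collection s ℓ}
  (𝐀 : QuantifierTheoryWithEquality 𝒮) where

  private
    module A where
      open QuantifierTheoryWithEquality 𝐀 public
      open IsQuantifierTheory isQuantifierTheory public
      open IsEquality isEquality public

    absurd : ∀ {c} {C : Set c} → .(NonEmpty (Var∅ 𝒮 nothing)) → C
    absurd ne = ⊥-elim-irr (NonEmpty.nonEmpty ne λ ())

  -- Normal 2-models: equality, attained infima and supports

  module NormalTwoModel {F : Fibre 𝐀} (isNTM : IsNormalTwoModel 𝐀 F) where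

    open IsNormalTwoModel isNTM public
    open IsQuantifierModel isQuantifierModel public
    open IsQuantifierTheory isQuantifierTheory public
    open IsEquality isEquality public
    open IsNormal isNormal public
    open RawTheory (extend 𝐀 F)
    open Fibre F using (Term∅; Eqᵗ∅; Form∅; subᵗ; subᶠ; e∅)
    open BooleanAlgebra Form∅ using (_≈_; _∧_; ⊤; ⊥; trans; ∧-congʳ) renaming (sym to ≈-sym)
    open BooleanAlgebraProperties Form∅ using (∧-identityˡ)

    module ≈ᵗ∅ = IsEquivalence (≈ᵗ-isEquivalence {nothing})

    ≈ᵗ⇒e≈⊤ : ∀ {a b} → Eqᵗ∅ a b → e∅ a b ≈ ⊤
    ≈ᵗ⇒e≈⊤ {a} a≈b = trans (e-cong {nothing} ≈ᵗ∅.refl (≈ᵗ∅.sym a≈b)) (E2 {nothing} a)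

    -- By normality, unequal `a` and `b` would make `e∅ a b` both `⊥` and `⊤`.
    e≈⊤⇒≈ᵗ : ∀ {a b} → e∅ a b ≈ ⊤ → Eqᵗ∅ a b
    e≈⊤⇒≈ᵗ {a} {b} e≈⊤ = em⇒dne em λ a≉b →
      M1ᶠ (trans (≈-sym (M3-unequal a b a≉b)) e≈⊤)

    -- If the infimum is `⊤`, every value is `⊤`, and some term exists by (M1). If it is `⊥` and not
    -- attained, every value is `⊤`, so `⊤` is a lower bound below `⊥`.
    all-attained : ∀ {X} .{{_ : NonEmpty (A.Var X)}} x (p : A.∣Form∣ X) (σ : A.Var X → Term∅) →
                   Σ[ d ∈ Term∅ ] subᶠ p (σ A.⟪ d / x ⟫) ≈ subᶠ (A.all x p) σ
    all-attained {X} {{ne}} x p σ = em⇒dne em λ none → refute none (proj₂ isTwo m)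
      where
      m = subᶠ (A.all x p) σ
      value-at : Term∅ → _
      value-at d = subᶠ p (σ A.⟪ d / x ⟫)
      infimum : IsInfimum Form∅ value-at m
      infimum = M2 {X = just (X , [ ne ])} x p σ
      refute : ¬ (Σ[ d ∈ Term∅ ] value-at d ≈ m) → ¬ (m ≈ ⊥ ⊎ m ≈ ⊤)
      refute none (inj₂ m≈⊤) = none (d , (begin
        value-at d      ≈⟨ ∧-identityˡ _ ⟨
        ⊤ ∧ value-at d  ≈⟨ ∧-congʳ m≈⊤ ⟨
        m ∧ value-at d  ≈⟨ proj₁ infimum d ⟨
        m               ∎))
        where
        open ≈-Reasoning (BooleanAlgebra.setoid Form∅)
        d = inhabitant em M1ᵗ
      refute none (inj₁ m≈⊥) = M1ᶠ (begin
        ⊥      ≈⟨ m≈⊥ ⟨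
        m      ≈⟨ ∧-identityˡ m ⟨
        ⊤ ∧ m  ≈⟨ proj₂ infimum ⊤ ⊤-lower ⟨
        ⊤      ∎)
        where
        open ≈-Reasoning (BooleanAlgebra.setoid Form∅)
        ⊤-lower : ∀ d → ⊤ ≈ ⊤ ∧ value-at d
        ⊤-lower d with proj₂ isTwo (value-at d)
        ... | inj₁ v≈⊥ = contradiction (d , trans v≈⊥ (≈-sym m≈⊥)) none
        ... | inj₂ v≈⊤ = ≈-sym (trans (∧-identityˡ _) v≈⊤)

    module _ {X} .{{ne : NonEmpty (A.Var X)}} {U : List (A.Var X)} where

      private
        X∅ : Index
        X∅ = just (X , [ ne ])

      model-supportᵗ : {t : A.Term X} → A.IsSupportᵗ (_∈ U) t → IsSupportᵗ {X∅} (_∈ U) t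
      model-supportᵗ {t} supp {Y} = supportᵗ em isQuantifierTheory t U
        (λ { {just Y} → supp ; {nothing} {{ne′}} → absurd ne′ }) {Y}

      model-supportᶠ : {p : A.∣Form∣ X} → A.IsSupportᶠ (_∈ U) p → IsSupportᶠ {X∅} (_∈ U) p
      model-supportᶠ {p} supp {Y} = supportᶠ em isQuantifierTheory p U
        (λ { {just Y} → supp ; {nothing} {{ne′}} → absurd ne′ }) {Y}

  -- The ultraproduct as a normal 2-model

  module Ultraproduct (lf : A.LocallyFinite) {𝓘 : Set ℓ}
    (B : 𝓘 → Fibre 𝐀) (isNTM : ∀ i → IsNormalTwoModel 𝐀 (B i))
    (I : Filter (Fibre.Form∅ (∏ B))) (isUltra : IsUltrafilter (Fibre.Form∅ (∏ B)) I) where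

    C : Fibre 𝐀
    C = (∏ B / I) /θ

    open RawTheory (extend 𝐀 C)

    private
      module B i = Fibre (B i)
      module M i = NormalTwoModel (isNTM i)

    open ReducedProduct B.Form∅ M.isTwo I

    ≈ᵗ⇒eventually : ∀ {a b} → Fibre.Eqᵗ∅ C a b → Eventually (λ i → B.Eqᵗ∅ i (a i) (b i))
    ≈ᵗ⇒eventually = eventually-map (λ i → M.e≈⊤⇒≈ᵗ i) ∘ ≈⇒eventually

    eventually⇒≈ᵗ : ∀ {a b} → Eventually (λ i → B.Eqᵗ∅ i (a i) (b i)) → Fibre.Eqᵗ∅ C a b
    eventually⇒≈ᵗ = eventually⇒≈ ∘ eventually-map (λ i → M.≈ᵗ⇒e≈⊤ i)

    pointwiseᵗ : ∀ {a b} → (∀ i → B.Eqᵗ∅ i (a i) (b i)) → Fibre.Eqᵗ∅ C a b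
    pointwiseᵗ = eventually⇒≈ᵗ ∘ always

    -- Projection to a coordinate passes through the case distinction of an override only once that
    -- distinction is resolved; (M2) relies on this bridge.
    override-coordinate : ∀ {X} x (σ : A.Var X → Fibre.Term∅ C) d i y →
      B.Eqᵗ∅ i ((σ A.⟪ d / x ⟫) y i) (((λ z → σ z i) A.⟪ d i / x ⟫) y)
    override-coordinate x σ d i y with does (y A.≟ x)
    ... | true  = M.≈ᵗ∅.refl i
    ... | false = M.≈ᵗ∅.refl i

    open IsQuantifierTheory

    isTheory : IsQuantifierTheory (extend 𝐀 C)
    isTheory .≈ᵗ-isEquivalence {just X} = A.≈ᵗ-isEquivalence
    isTheory .≈ᵗ-isEquivalence {nothing} = record
      { refl  = pointwiseᵗ λ i → M.≈ᵗ∅.refl i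
      ; sym   = eventually⇒≈ᵗ ∘ eventually-map (λ i → M.≈ᵗ∅.sym i) ∘ ≈ᵗ⇒eventually
      ; trans = λ a≈b b≈c → eventually⇒≈ᵗ
          (eventually-map (λ { i (u , v) → M.≈ᵗ∅.trans i u v })
            (eventually-× (≈ᵗ⇒eventually a≈b) (≈ᵗ⇒eventually b≈c)))
      }
    isTheory .·ᵗ-cong {nothing} {{ne}} = absurd ne
    isTheory .·ᵗ-cong {just X} {just Y} {{ne}} = A.·ᵗ-cong {{ne}}
    isTheory .·ᵗ-cong {just X} {nothing} {{ne}} {a} {b} {σ} {τ} a≈b σ≈τ
      with A.LocallyFinite.finiteSupportᵗ lf {{ne}} a
    -- `U` is chosen in `𝐀`, independently of the coordinate, so one member of `I` makes `σ` and `τ`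
    -- agree on all of `U`. There the substitution is changed first, then the term.
    ... | U , supp = eventually⇒≈ᵗ (eventually-map
      (λ i σ≈τ-on-U → M.≈ᵗ∅.trans i
        (M.model-supportᵗ i {{ne}} supp {nothing} _ _ (σ≈τ-on-U _))
        (M.·ᵗ-cong i {just X} {nothing} {{ne}} a≈b (λ _ → M.≈ᵗ∅.refl i)))
      (eventually-∀∈ U (≈ᵗ⇒eventually ∘ σ≈τ)))
    isTheory .·ᶠ-cong {nothing} {{ne}} = absurd ne
    isTheory .·ᶠ-cong {just X} {just Y} {{ne}} = A.·ᶠ-cong {{ne}}
    isTheory .·ᶠ-cong {just X} {nothing} {{ne}} {p} {q} {σ} {τ} p≈q σ≈τ
      with A.LocallyFinite.finiteSupportᶠ lf {{ne}} p
    ... | U , supp = eventually⇒≈ (eventually-map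
      (λ i σ≈τ-on-U → BooleanAlgebra.trans (B.Form∅ i)
        (M.model-supportᶠ i {{ne}} supp {nothing} _ _ (σ≈τ-on-U _))
        (M.·ᶠ-cong i {just X} {nothing} {{ne}} p≈q (λ _ → M.≈ᵗ∅.refl i)))
      (eventually-∀∈ U (≈ᵗ⇒eventually ∘ σ≈τ)))
    -- Axioms about a chosen variable of `X` have no case at the empty set, which offers no variable
    -- to choose.
    isTheory .all-cong {just X} = A.all-cong
    isTheory .P1ᵗ {nothing} {{ne}} = absurd ne
    isTheory .P1ᵗ {just X} {{ne}} = A.P1ᵗ {{ne}}
    isTheory .P1ᶠ {nothing} {{ne}} = absurd ne
    isTheory .P1ᶠ {just X} {{ne}} = A.P1ᶠ {{ne}}
    isTheory .P2ᵗ {nothing} {{ne}} = absurd ne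
    isTheory .P2ᵗ {just X} {nothing} {{_}} {{ne}} = absurd ne
    isTheory .P2ᵗ {just X} {just Y} {just W} {{ne}} {{ne′}} = A.P2ᵗ {{ne}} {{ne′}}
    isTheory .P2ᵗ {just X} {just Y} {nothing} {{ne}} {{ne′}} t σ τ =
      pointwiseᵗ λ i → M.P2ᵗ i {just X} {just Y} {nothing} {{ne}} {{ne′}} t σ λ y → τ y i
    isTheory .P2ᶠ {nothing} {{ne}} = absurd ne
    isTheory .P2ᶠ {just X} {nothing} {{_}} {{ne}} = absurd ne
    isTheory .P2ᶠ {just X} {just Y} {just W} {{ne}} {{ne′}} = A.P2ᶠ {{ne}} {{ne′}}
    isTheory .P2ᶠ {just X} {just Y} {nothing} {{ne}} {{ne′}} p σ τ =
      pointwise λ i → M.P2ᶠ i {just X} {just Y} {nothing} {{ne}} {{ne′}} p σ λ y → τ y i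
    isTheory .P3 {just X} {just Y} {{ne}} = A.P3 {{ne}}
    isTheory .P3 {just X} {nothing} {{ne}} x σ =
      pointwiseᵗ λ i → M.P3 i {just X} {nothing} {{ne}} x λ y → σ y i
    isTheory .P4 {nothing} {{ne}} = absurd ne
    isTheory .P4 {just X} {just Y} {{ne}} = A.P4 {{ne}}
    isTheory .P4 {just X} {nothing} {{ne}} σ = record
      { isLatticeHomomorphism = record
        { isRelHomomorphism = record
          { cong = λ p≈q → pointwise λ i → ⟦⟧-cong (lattice i) p≈q }
        ; ∧-homo = λ p q → pointwise λ i → ∧-homo (lattice i) p q
        ; ∨-homo = λ p q → pointwise λ i → ∨-homo (lattice i) p q
        }
      ; ¬-homo = λ p → pointwise λ i → ¬-homo (homo i) p
      ; ⊤-homo = pointwise λ i → ⊤-homo (homo i)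
      ; ⊥-homo = pointwise λ i → ⊥-homo (homo i)
      }
      where
      open IsBooleanHomomorphism
      open LatticeMorphisms.IsLatticeHomomorphism
      homo = λ i → M.P4 i {just X} {nothing} {{ne}} λ x → σ x i
      lattice = λ i → isLatticeHomomorphism (homo i)
    isTheory .P5 {just X} {just Y} {{ne}} {{ne′}} = A.P5 {{ne}} {{ne′}}
    isTheory .Q1 {just X} = A.Q1
    isTheory .Q2 {just X} = A.Q2
    isTheory .Q3 {just X} {{ne}} = A.Q3 {{ne}}
    isTheory .nontrivial with A.nontrivial
    -- `𝒮` may contain empty sets, which the modification replaces by `nothing`. Closedness there
    -- thus tests only the nonempty targets of `𝐀`; `supportᶠ` with the empty list recovers the
    -- others.
    ... | X , ne , p , ¬closed = just (X , [ ne ]) , ne , p , λ closed →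
      ¬closed λ σ τ _ → supportᶠ em A.isQuantifierTheory {{ne}} p []
        (λ {Y} {{ne′}} σ τ _ → closed {just (Y , [ ne′ ])} σ τ λ ()) σ τ λ ()

    isModel : IsQuantifierModel (extend 𝐀 C) nothing
    isModel .IsQuantifierModel.O-empty ()
    isModel .IsQuantifierModel.isQuantifierTheory = isTheory
    isModel .IsQuantifierModel.M1ᵗ = record
      { nonEmpty = λ empty → empty λ i → inhabitant em (M.M1ᵗ i) }
    isModel .IsQuantifierModel.M1ᶠ = proj₁ (ultrafilter-isTwo _ I isUltra)
    isModel .IsQuantifierModel.M2 {nothing} {{ne}} = absurd ne
    isModel .IsQuantifierModel.M2 {just X} {{ne}} x p σ = lower , greatest
      where
      module F = BooleanAlgebra (Fibre.Form∅ C)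
      at : Fibre.Term∅ C → F.Carrier
      at d = Fibre.subᶠ C {{ne}} p (σ A.⟪ d / x ⟫)
      m : F.Carrier
      m = Fibre.subᶠ C {{ne}} (A.all x p) σ
      at-coordinate : ∀ d i → BooleanAlgebra._≈_ (B.Form∅ i)
        (B.subᶠ i {{ne}} p ((λ y → σ y i) A.⟪ d i / x ⟫)) (at d i)
      at-coordinate d i = M.·ᶠ-cong i {just X} {nothing} {{ne}} (A.Form.refl (value X))
        λ y → M.≈ᵗ∅.sym i (override-coordinate x σ d i y)
      lower : ∀ d → m F.≈ m F.∧ at d
      lower d = pointwise λ i → BooleanAlgebra.trans (B.Form∅ i)
        (proj₁ (M.M2 i {just X} {{ne}} x p (λ y → σ y i)) (d i))
        (BooleanAlgebra.∧-congˡ (B.Form∅ i) (at-coordinate d i))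
      attained : ∀ i → _
      attained i = M.all-attained i {{ne}} x p λ y → σ y i
      -- `all-attained` yields its witness as data, so the witnesses assemble into one element of
      -- the product.
      d₀ : Fibre.Term∅ C
      d₀ i = proj₁ (attained i)
      at-d₀≈m : at d₀ F.≈ m
      at-d₀≈m = pointwise λ i → BooleanAlgebra.trans (B.Form∅ i)
        (BooleanAlgebra.sym (B.Form∅ i) (at-coordinate d₀ i)) (proj₂ (attained i))
      -- The member of `I` on which `q` lies below `at d` may vary with `d`, so greatest lower
      -- bounds cannot simply be combined coordinatewise. Testing at `d₀` alone suffices, because
      -- `m` is the value there.
      greatest : ∀ q → (∀ d → q F.≈ q F.∧ at d) → q F.≈ q F.∧ m
      greatest q q≤at = F.trans (q≤at d₀) (F.∧-congˡ at-d₀≈m)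

    open IsNormalTwoModel

    isNormalTwoModel : IsNormalTwoModel 𝐀 C
    isNormalTwoModel .isQuantifierModel = isModel
    isNormalTwoModel .isTwo = ultrafilter-isTwo _ I isUltra
    isNormalTwoModel .isEquality .IsEquality.e-cong {just X} = A.e-cong
    isNormalTwoModel .isEquality .IsEquality.e-cong {nothing} a≈a′ b≈b′ = eventually⇒≈
      (eventually-map (λ { i (u , v) → M.e-cong i {nothing} u v })
        (eventually-× (≈ᵗ⇒eventually a≈a′) (≈ᵗ⇒eventually b≈b′)))
    isNormalTwoModel .isEquality .IsEquality.E1 {nothing} {{ne}} = absurd ne
    isNormalTwoModel .isEquality .IsEquality.E1 {just X} {just Y} {{ne}} = A.E1 {{ne}}
    isNormalTwoModel .isEquality .IsEquality.E1 {just X} {nothing} {{ne}} a b σ =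
      pointwise λ i → M.E1 i {just X} {nothing} {{ne}} a b λ x → σ x i
    isNormalTwoModel .isEquality .IsEquality.E2 {just X} = A.E2
    isNormalTwoModel .isEquality .IsEquality.E2 {nothing} a =
      pointwise λ i → M.E2 i {nothing} (a i)
    isNormalTwoModel .isEquality .IsEquality.E3 {just X} {{ne}} = A.E3 {{ne}}
    isNormalTwoModel .isNormal .IsNormal.M3-equal a = pointwise λ i → M.M3-equal i (a i)
    isNormalTwoModel .isNormal .IsNormal.M3-unequal a b a≉b
      with proj₂ (ultrafilter-isTwo _ I isUltra) (Fibre.e∅ C a b)
    ... | inj₁ e≈⊥ = e≈⊥
    -- Equality of terms in `C` is by definition `e∅ a b ≈ ⊤`.
    ... | inj₂ e≈⊤ = contradiction e≈⊤ a≉b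

theorem36 : ∀ {s ℓ} → ExcludedMiddle ℓ →
    (𝒮 : Collection s ℓ) (𝐀 : QuantifierTheoryWithEquality 𝒮) →
    QuantifierTheoryWithEquality.LocallyFinite 𝐀 →
    (𝓘 : Set ℓ) → NonEmpty 𝓘 →
    (B : 𝓘 → Fibre 𝐀) → (∀ i → IsNormalTwoModel 𝐀 (B i)) →
    (I : Filter (Fibre.Form∅ (∏ B))) → IsUltrafilter (Fibre.Form∅ (∏ B)) I →
    IsNormalTwoModel 𝐀 ((∏ B / I) /θ)
theorem36 em 𝒮 𝐀 lf 𝓘 _ B isNTM I isUltra =
  Ultraproduct.isNormalTwoModel em 𝐀 lf B isNTM I isUltra
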